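{- Let $(W,S)$ be a finite Coxeter system, $Q=q_1\cdots q_m$ a word on $S$, and $\rho\in W$. Let $I$ be a facet of $\mathcal{SC}(Q,\rho)$. If $I\ne\mathsf N(Q,\rho)$, then the father of $I$ in the positive sink tree $\mathcal P^*(Q,\rho)$ is obtained from $I$ by flipping the smallest position in $I\setminus\mathsf N(Q,\rho)$. Similarly, if $I\neq\mathsf P(Q,\rho)$, then the father of $I$ in the negative source tree $\mathcal N(Q,\rho)$ is obtained from $I$ by flipping the largest position in $I\setminus\mathsf P(Q,\rho)$.
   Context: Let $(W,S)$ be a finite Coxeter system with length function $\ell$, let $Q=q_1q_2\cdots q_m$ be a word in the letters $S$, and let $\rho\in W$. Write $[m]=\{1,\dots,m\}$. The subword complex $\mathcal{SC}(Q,\rho)$ is the simplicial complex whose facets are the sets $I\subseteq[m]$ such that the letters of $Q$ at the positions in $[m]\setminus I$, read in increasing order of position, form a reduced expression of $\rho$. Two distinct facets $I,J$ are adjacent if $I\setminus\{i\}=J\setminus\{j\}$ for some $i\in I$, $j\in J$; then $J$ is obtained from $I$ by flipping $i$ (given $I$ and $i$, the facet $J\ne I$ is unique if it exists). The flip is increasing if $i<j$. The increasing flip graph $\mathcal G(Q,\rho)$ is the directed graph whose vertices are the facets of $\mathcal{SC}(Q,\rho)$ and whose edges $I\to J$ are the increasing flips. For an edge $I\to J$ with $I\setminus\{i\}=J\setminus\{j\}$, $i<j$, set $\mathsf p(I\to J)=i$ and $\mathsf n(I\to J)=j$. For $\lambda\in\{\mathsf p,\mathsf n\}$, a path is $\lambda$-rising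 if the sequence of $\lambda$-labels of its successive edges is strictly increasing; whenever there is a directed path from one facet to another, there is a unique $\lambda$-rising path. The positive greedy facet $\mathsf P(Q,\rho)$ is the unique source of $\mathcal G(Q,\rho)$ (the lexicographically smallest facet) and the negative greedy facet $\mathsf N(Q,\rho)$ is the unique sink (the lexicographically largest facet). The positive sink tree $\mathcal P^*(Q,\rho)$ is the spanning tree of $\mathcal G(Q,\rho)$ formed by all $\mathsf p$-rising paths from the facets to $\mathsf N(Q,\rho)$, rooted at $\mathsf N(Q,\rho)$; the father of $I\neq\mathsf N(Q,\rho)$ is the facet following $I$ on the $\mathsf p$-rising path from $I$ to $\mathsf N(Q,\rho)$. The negative source tree $\mathcal N(Q,\rho)$ is the spanning tree formed by all $\mathsf n$-rising paths from $\mathsf P(Q,\rho)$ to the facets, rooted at $\mathsf P(Q,\rho)$; the father of $I\ne\mathsf P(Q,\rho)$ is the facet preceding $I$ on the $\mathsf n$-rising path from $\mathsf P(Q,\rho)$ to $I$. -}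

module Defs where

open import Algebra.Bundles using (Group)
open import Data.Fin.Base using (Fin; _<_; _≤_)
open import Data.Fin.Subset using (Subset; inside; outside; _∈_; _-_; ∁)
open import Data.List.Base using (List; []; _∷_; _++_; foldr; length; concat; replicate)
open import Data.List.Relation.Unary.Linked using (Linked)
open import Data.Nat.Base as ℕ using (ℕ)
open import Data.Product using (Σ-syntax; ∃-syntax; _×_; _,_)
open import Data.Vec.Base using (Vec; []; _∷_)
open import Function.Bundles using (Inverse)
open import Level using (Level; suc; _⊔_)
open import Relation.Binary.Construct.Closure.Equivalence using (EqClosure)
open import Relation.Binary.Construct.Closure.ReflexiveTransitive using (Star; ε; _◅_; _◅◅_)
open import Relation.Binary.PropositionalEquality using (_≡_; _≢_; setoid)
open import Relation.Nullary using (¬_)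

-- An entry 0 stands for ∞, that is, for the absence of a relation.
record CoxeterMatrix (n : ℕ) : Set where
  field
    M         : Fin n → Fin n → ℕ
    symmetric : ∀ i j → M i j ≡ M j i
    diagonal  : ∀ i → M i i ≡ 1
    off-diag  : ∀ i j → i ≢ j → M i j ≢ 1

module Presentation {n : ℕ} (cox : CoxeterMatrix n) where
  open CoxeterMatrix cox

  Word : Set
  Word = List (Fin n)

  relator : Fin n → Fin n → Word
  relator i j = concat (replicate (M i j) (i ∷ j ∷ []))

  data _⇝_ : Word → Word → Set where
    delete : ∀ u i j v → (u ++ relator i j ++ v) ⇝ (u ++ v)

  -- Equality in ⟨ s₁,…,sₙ | (sᵢsⱼ)^(M i j) = 1 ⟩. Because M i i = 1, each
  -- generator is its own inverse, so words without formal inverses suffice and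
  -- the monoid presentation coincides with the group presentation.
  _∼_ : Word → Word → Set
  _∼_ = EqClosure _⇝_

-- A group together with generators exhibiting it as the group presented by a
-- Coxeter matrix: evaluation of words induces a bijection from words modulo _∼_.
record CoxeterSystem (c ℓ : Level) : Set (suc (c ⊔ ℓ)) where
  field
    group         : Group c ℓ
    rank          : ℕ
    coxeterMatrix : CoxeterMatrix rank

  open Group group using (Carrier; _≈_; _∙_) renaming (ε to 1#) public
  open Presentation coxeterMatrix public

  field
    gen : Fin rank → Carrier

  eval : Word → Carrier
  eval = foldr (λ i w → gen i ∙ w) 1#

  field
    generates : ∀ w → ∃[ u ] eval u ≈ w
    relations : ∀ i j → eval (relator i j) ≈ 1#
    presents  : ∀ u v → eval u ≈ eval v → u ∼ v

  IsLength : Carrier → ℕ → Set ℓ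
  IsLength w k = (∃[ u ] (eval u ≈ w × length u ≡ k))
               × (∀ u → eval u ≈ w → k ℕ.≤ length u)

  IsReducedExpression : Word → Carrier → Set ℓ
  IsReducedExpression u w = eval u ≈ w × IsLength w (length u)

IsFinite : ∀ {c ℓ} → Group c ℓ → Set (c ⊔ ℓ)
IsFinite G = ∃[ N ] Inverse (Group.setoid G) (setoid (Fin N))

select : ∀ {a} {A : Set a} {m} → Subset m → Vec A m → List A
select []            []      = []
select (inside  ∷ X) (q ∷ Q) = q ∷ select X Q
select (outside ∷ X) (q ∷ Q) = select X Q

IsSmallest IsLargest : ∀ {m} → Fin m → Subset m → Set
IsSmallest i X = i ∈ X × (∀ k → k ∈ X → i ≤ k)
IsLargest  i X = i ∈ X × (∀ k → k ∈ X → k ≤ i)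

module SubwordComplex {c ℓ : Level} (C : CoxeterSystem c ℓ) {m : ℕ}
                      (Q : Vec (Fin (CoxeterSystem.rank C)) m)
                      (ρ : CoxeterSystem.Carrier C) where

  open CoxeterSystem C

  IsFacet : Subset m → Set ℓ
  IsFacet I = IsReducedExpression (select (∁ I) Q) ρ

  record Adjacent (I J : Subset m) : Set ℓ where
    field
      facetˡ    : IsFacet I
      facetʳ    : IsFacet J
      distinct  : I ≢ J
      removed   : Fin m
      inserted  : Fin m
      removed∈  : removed ∈ I
      inserted∈ : inserted ∈ J
      exchange  : I - removed ≡ J - inserted

  open Adjacent

  FlipsTo : Subset m → Fin m → Subset m → Set ℓ
  FlipsTo I i J = Σ[ a ∈ Adjacent I J ] removed a ≡ i

  -- The increasing flip graph.
  _⟶_ : Subset m → Subset m → Set ℓ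
  I ⟶ J = Σ[ a ∈ Adjacent I J ] removed a < inserted a

  Labelling : Set ℓ
  Labelling = ∀ {I J} → I ⟶ J → Fin m

  𝗉 𝗇 : Labelling
  𝗉 (a , _) = removed a
  𝗇 (a , _) = inserted a

  labels : Labelling → ∀ {I J} → Star _⟶_ I J → List (Fin m)
  labels lab ε       = []
  labels lab (e ◅ π) = lab e ∷ labels lab π

  Rising : Labelling → ∀ {I J} → Star _⟶_ I J → Set
  Rising lab π = Linked _<_ (labels lab π)

  -- The positive greedy facet is the source, and the negative greedy facet the
  -- sink, of the increasing flip graph; their uniqueness is not built in.
  IsPositiveGreedy IsNegativeGreedy : Subset m → Set ℓ
  IsPositiveGreedy P = IsFacet P × (∀ I → ¬ (I ⟶ P))
  IsNegativeGreedy N = IsFacet N × (∀ I → ¬ (N ⟶ I))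

  -- J is the father of I in the positive sink tree rooted at N: it follows I on
  -- a 𝗉-rising path from I to N.
  IsPositiveSinkFather : (N I J : Subset m) → Set ℓ
  IsPositiveSinkFather N I J =
    Σ[ e ∈ I ⟶ J ] Σ[ π ∈ Star _⟶_ J N ] Rising 𝗉 (e ◅ π)

  -- J is the father of I in the negative source tree rooted at P: it precedes I
  -- on an 𝗇-rising path from P to I.
  IsNegativeSourceFather : (P I J : Subset m) → Set ℓ
  IsNegativeSourceFather P I J =
    Σ[ π ∈ Star _⟶_ P J ] Σ[ e ∈ J ⟶ I ] Rising 𝗇 (π ◅◅ (e ◅ ε))

{-# OPTIONS --safe #-}
module Submission where

open import Defs
open import Algebra.Bundles using (Group)
open import Data.Bool.Base using (Bool; true; false; not; _xor_)
import Data.Bool.Properties as Bool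
open import Data.Fin.Base using (Fin; zero; suc; _<_; _≤_)
open import Data.Fin.Induction using (<-wellFounded; >-wellFounded)
import Data.Fin.Properties as Fin
open import Data.Fin.Subset using (Subset; inside; outside; _∈_; _-_; _─_; ∁)
open import Data.Fin.Subset.Properties using (p─⊥≡p; x∈p∧x∉q⇒x∈p─q)
open import Data.List.Base using (List; []; _∷_; _++_; concat; length; replicate; reverse)
open import Data.List.Properties using (unfold-reverse)
open import Data.List.Relation.Unary.All as All using (All; []; _∷_)
import Data.List.Relation.Unary.All.Properties as All
open import Data.List.Relation.Unary.AllPairs using (AllPairs; []; _∷_)
import Data.List.Relation.Unary.AllPairs.Properties as AllPairs
import Data.List.Relation.Unary.Any.Properties as Any
open import Data.List.Relation.Unary.Linked.Properties using (Linked⇒AllPairs; AllPairs⇒Linked)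
open import Data.Nat.Base as ℕ using (ℕ; zero; suc; _+_; s≤s; z≤n)
import Data.Nat.Properties as ℕ
open import Data.Product using (∃-syntax; ∃!; _×_; _,_; proj₁; proj₂)
open import Data.Vec.Base using (Vec; []; _∷_; here; there; lookup; tabulate; updateAt; _[_]≔_)
open import Data.Vec.Properties
  using (lookup∘updateAt; lookup∘updateAt′; updateAt-commutes; lookup∘update; lookup∘update′;
         tabulate∘lookup; tabulate-cong; []=⇒lookup; lookup⇒[]=; ≡-dec)
open import Function.Base using (_∘_; flip)
open import Function.Bundles using (_⇔_; mk⇔; Equivalence)
open import Function.Properties.Inverse using (Inverse⇒Injection)
open import Induction.WellFounded using (WellFounded; Acc; acc)
open import Level using (0ℓ)
import Relation.Binary.Construct.Closure.Equivalence as EqClosure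
open import Relation.Binary.Construct.Closure.ReflexiveTransitive using (Star; ε; _◅_; _◅◅_)
import Relation.Binary.Construct.Flip.EqAndOrd as Flip
open import Relation.Binary.Core using (Rel)
open import Relation.Binary.Definitions using (Decidable; tri<; tri≈; tri>)
open import Relation.Binary.PropositionalEquality as ≡ using (_≡_; _≢_; refl; cong; cong₂)
open import Relation.Binary.Structures using (IsStrictTotalOrder)
open import Relation.Nullary using (¬_; yes; no; contradiction)
open import Relation.Nullary.Decidable
  using (does; does-⇔; via-injection; decidable-stable; _×-dec_; ¬?)

-- The parity of the number of times a reflection t occurs among the
-- u₁⋯uₖ₋₁ uₖ uₖ₋₁⋯u₁ depends only on the value of the word u, because it is
-- unchanged by deleting a relator. This gives the exchange condition in the form
-- needed here: let I and N be facets that agree before i, with i ∈ I and i ∉ N.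
-- The reflection at i is the same for I and N, so it occurs exactly once for N,
-- hence an odd number of times for I, say at j ∉ I. Then i can be flipped to j,
-- and j > i since otherwise the expression of N would not be reduced. Iterating,
-- a 𝗉-rising path fixes the positions from left to right. Conversely all
-- positions up to the first label of a 𝗉-rising path to N have reached their
-- final state after the first flip, so that label is the smallest element of
-- I ─ N. The same argument with the order of positions reversed handles 𝗇; the
-- reflections at i then agree because they can be computed from the suffix and ρ.

-- Counting how often a reflection occurs requires deciding equality in the group; finiteness
-- provides this by comparing indices in `Fin N`.
finite⇒decidable : ∀ {c ℓ} (G : Group c ℓ) → IsFinite G → Decidable (Group._≈_ G)
finite⇒decidable G (_ , inv) = via-injection (Inverse⇒Injection inv) Fin._≟_

-- Conjugation by generators and reflections along a word.

module Inversions {c ℓ} (C : CoxeterSystem c ℓ) where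

  open CoxeterSystem C
  open Group group public
    using (setoid; assoc; identityˡ; identityʳ; inverseʳ; ∙-cong; ∙-congˡ; ∙-congʳ; _⁻¹)
    renaming (refl to ≈-refl; sym to ≈-sym; trans to ≈-trans; reflexive to ≈-reflexive)
  open import Relation.Binary.Reasoning.Setoid setoid public

  gen² : ∀ i → gen i ∙ gen i ≈ 1#
  gen² i = begin
    gen i ∙ gen i                ≈⟨ ∙-congˡ (identityʳ _) ⟨
    eval (i ∷ i ∷ [])            ≡⟨ cong (λ k → eval (concat (replicate k (i ∷ i ∷ []))))
                                         (CoxeterMatrix.diagonal coxeterMatrix i) ⟨
    eval (relator i i)           ≈⟨ relations i i ⟩
    1#                           ∎

  gen-cancelˡ : ∀ i x → gen i ∙ (gen i ∙ x) ≈ x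
  gen-cancelˡ i x = begin
    gen i ∙ (gen i ∙ x)  ≈⟨ assoc _ _ _ ⟨
    gen i ∙ gen i ∙ x    ≈⟨ ∙-congʳ (gen² i) ⟩
    1# ∙ x               ≈⟨ identityˡ x ⟩
    x                    ∎

  gen-cancelʳ : ∀ i x → x ∙ gen i ∙ gen i ≈ x
  gen-cancelʳ i x = begin
    x ∙ gen i ∙ gen i    ≈⟨ assoc _ _ _ ⟩
    x ∙ (gen i ∙ gen i)  ≈⟨ ∙-congˡ (gen² i) ⟩
    x ∙ 1#               ≈⟨ identityʳ x ⟩
    x                    ∎

  conj : Fin rank → Carrier → Carrier
  conj i t = gen i ∙ t ∙ gen i

  conj-cong : ∀ i {x y} → x ≈ y → conj i x ≈ conj i y
  conj-cong i x≈y = ∙-congʳ (∙-congˡ x≈y)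

  conj-involutive : ∀ i x → conj i (conj i x) ≈ x
  conj-involutive i x = begin
    gen i ∙ (gen i ∙ x ∙ gen i) ∙ gen i    ≈⟨ ∙-congʳ (assoc _ _ _) ⟨
    gen i ∙ (gen i ∙ x) ∙ gen i ∙ gen i    ≈⟨ gen-cancelʳ i _ ⟩
    gen i ∙ (gen i ∙ x)                    ≈⟨ gen-cancelˡ i x ⟩
    x                                      ∎

  conj-swap : ∀ i {x y} → conj i x ≈ y → x ≈ conj i y
  conj-swap i {x} {y} eq = ≈-trans (≈-sym (conj-involutive i x)) (conj-cong i eq)

  conj-conj : ∀ i j x → conj i (conj j x) ≈ gen i ∙ gen j ∙ x ∙ (gen j ∙ gen i)
  conj-conj i j x = begin
    gen i ∙ (gen j ∙ x ∙ gen j) ∙ gen i    ≈⟨ ∙-congʳ (assoc _ _ _) ⟨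
    gen i ∙ (gen j ∙ x) ∙ gen j ∙ gen i    ≈⟨ assoc _ _ _ ⟩
    gen i ∙ (gen j ∙ x) ∙ (gen j ∙ gen i)  ≈⟨ ∙-congʳ (assoc _ _ _) ⟨
    gen i ∙ gen j ∙ x ∙ (gen j ∙ gen i)    ∎

  -- The parity of a reflection as an invariant of the group element.

  module Parity (_≟_ : Decidable _≈_) where

    -- Counts modulo 2 the k such that u₁⋯uₖ₋₁ uₖ uₖ₋₁⋯u₁ ≈ t.
    parity : Word → Carrier → Bool
    parity []      t = false
    parity (i ∷ u) t = does (gen i ≟ t) xor parity u (conj i t)

    ≟-cong : ∀ {x y s t} → (x ≈ s → y ≈ t) → (y ≈ t → x ≈ s) → does (x ≟ s) ≡ does (y ≟ t)
    ≟-cong to from = does-⇔ (mk⇔ to from) (_ ≟ _) (_ ≟ _)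

    parity-cong : ∀ u {s t} → s ≈ t → parity u s ≡ parity u t
    parity-cong []      s≈t = refl
    parity-cong (i ∷ u) s≈t = cong₂ _xor_
      (≟-cong (λ p → ≈-trans p s≈t) (λ p → ≈-trans p (≈-sym s≈t)))
      (parity-cong u (conj-cong i s≈t))

    -- The conjugate u⁻¹ t u, in the recursive form in which `parity` passes its argument along `u`.
    unwind : Word → Carrier → Carrier
    unwind []      t = t
    unwind (i ∷ u) t = unwind u (conj i t)

    unwind-eval : ∀ u t → eval u ∙ unwind u t ≈ t ∙ eval u
    unwind-eval []      t = ≈-trans (identityˡ t) (≈-sym (identityʳ t))
    unwind-eval (i ∷ u) t = begin
      gen i ∙ eval u ∙ unwind u (conj i t)    ≈⟨ assoc _ _ _ ⟩
      gen i ∙ (eval u ∙ unwind u (conj i t))  ≈⟨ ∙-congˡ (unwind-eval u _) ⟩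
      gen i ∙ (gen i ∙ t ∙ gen i ∙ eval u)    ≈⟨ ∙-congˡ (≈-trans (assoc _ _ _) (assoc _ _ _)) ⟩
      gen i ∙ (gen i ∙ (t ∙ (gen i ∙ eval u)))  ≈⟨ gen-cancelˡ i _ ⟩
      t ∙ (gen i ∙ eval u)                    ∎

    parity-++ : ∀ u v t → parity (u ++ v) t ≡ parity u t xor parity v (unwind u t)
    parity-++ []      v t = refl
    parity-++ (i ∷ u) v t = ≡.trans
      (cong (does (gen i ≟ t) xor_) (parity-++ u v (conj i t)))
      (≡.sym (Bool.xor-assoc (does (gen i ≟ t)) _ _))

    module Dihedral (i j : Fin rank) where

      c₀ : Carrier
      c₀ = gen i ∙ gen j

      -- Counts modulo 2 the k < n with c₀ᵏ x ≈ t. Working with orbits of left multiplication lets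
      -- the relation c₀ᵐ = 1 act as a shift of the index.
      orbitParity : ℕ → Carrier → Carrier → Bool
      orbitParity zero    x t = false
      orbitParity (suc n) x t = does (x ≟ t) xor orbitParity n (c₀ ∙ x) t

      orbitParity-cong : ∀ n {x y} t → x ≈ y → orbitParity n x t ≡ orbitParity n y t
      orbitParity-cong zero    t x≈y = refl
      orbitParity-cong (suc n) t x≈y = cong₂ _xor_
        (≟-cong (≈-trans (≈-sym x≈y)) (≈-trans x≈y))
        (orbitParity-cong n t (∙-congˡ x≈y))

      power : ℕ → Word
      power n = concat (replicate n (i ∷ j ∷ []))

      power-comm : ∀ n x → eval (power n) ∙ (c₀ ∙ x) ≈ c₀ ∙ (eval (power n) ∙ x)
      power-comm zero    x = ≈-trans (identityˡ _) (∙-congˡ (≈-sym (identityˡ x)))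
      power-comm (suc n) x = begin
        gen i ∙ (gen j ∙ eval (power n)) ∙ (c₀ ∙ x)  ≈⟨ ∙-congʳ (assoc _ _ _) ⟨
        c₀ ∙ eval (power n) ∙ (c₀ ∙ x)               ≈⟨ assoc _ _ _ ⟩
        c₀ ∙ (eval (power n) ∙ (c₀ ∙ x))             ≈⟨ ∙-congˡ (power-comm n x) ⟩
        c₀ ∙ (c₀ ∙ (eval (power n) ∙ x))             ≈⟨ ∙-congˡ (assoc _ _ _) ⟨
        c₀ ∙ (c₀ ∙ eval (power n) ∙ x)               ≈⟨ ∙-congˡ (∙-congʳ (assoc _ _ _)) ⟩
        c₀ ∙ (eval (power (suc n)) ∙ x)              ∎

      orbitParity-+ : ∀ n p x t →
        orbitParity (n + p) x t ≡ orbitParity n x t xor orbitParity p (eval (power n) ∙ x) t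
      orbitParity-+ zero    p x t = orbitParity-cong p t (≈-sym (identityˡ x))
      orbitParity-+ (suc n) p x t = ≡.trans
        (cong (does (x ≟ t) xor_) (≡.trans (orbitParity-+ n p (c₀ ∙ x) t)
          (cong (orbitParity n (c₀ ∙ x) t xor_) (orbitParity-cong p t shift))))
        (≡.sym (Bool.xor-assoc (does (x ≟ t)) _ _))
        where
        shift : eval (power n) ∙ (c₀ ∙ x) ≈ eval (power (suc n)) ∙ x
        shift = begin
          eval (power n) ∙ (c₀ ∙ x)    ≈⟨ power-comm n x ⟩
          c₀ ∙ (eval (power n) ∙ x)    ≈⟨ assoc _ _ _ ⟨
          c₀ ∙ eval (power n) ∙ x      ≈⟨ ∙-congʳ (assoc _ _ _) ⟩
          eval (power (suc n)) ∙ x     ∎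

      -- The hypothesis says that `x` inverts the rotation, x c₀⁻¹ = c₀ x, as a reflection of the
      -- dihedral group does. Conjugating `x` by `c₀` then multiplies it by c₀², and the hypothesis
      -- passes on to `c₀ ∙ x`.
      orbitParity-conj : ∀ n x t → x ∙ (gen j ∙ gen i) ≈ c₀ ∙ x →
        orbitParity n x (conj j (conj i t)) ≡ orbitParity n (c₀ ∙ (c₀ ∙ x)) t
      orbitParity-conj zero    x t eq = refl
      orbitParity-conj (suc n) x t eq = cong₂ _xor_
        (≟-cong (λ p → ≈-trans (≈-sym conj-x) (≈-sym (conj-swap i (conj-swap j (≈-sym p)))))
                (λ p → conj-swap j (conj-swap i (≈-trans conj-x p))))
        (orbitParity-conj n (c₀ ∙ x) t (≈-trans (assoc _ _ _) (∙-congˡ eq)))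
        where
        conj-x : conj i (conj j x) ≈ c₀ ∙ (c₀ ∙ x)
        conj-x = begin
          conj i (conj j x)              ≈⟨ conj-conj i j x ⟩
          c₀ ∙ x ∙ (gen j ∙ gen i)       ≈⟨ assoc _ _ _ ⟩
          c₀ ∙ (x ∙ (gen j ∙ gen i))     ≈⟨ ∙-congˡ eq ⟩
          c₀ ∙ (c₀ ∙ x)                  ∎

      -- The reflections met along (sᵢsⱼ)ⁿ are c₀ᵏ sᵢ for k < 2n.
      parity-power : ∀ n t → parity (power n) t ≡ orbitParity (n + n) (gen i) t
      parity-power zero    t = refl
      parity-power (suc n) t rewrite ℕ.+-suc n n = cong (does (gen i ≟ t) xor_) (cong₂ _xor_
        (≟-cong (λ p → ≈-sym (conj-swap i (≈-sym p))) (conj-swap i))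
        (≡.trans (parity-power n _) (orbitParity-conj (n + n) (gen i) t (≈-sym (assoc _ _ _)))))

      -- Of the 2m reflections the last m repeat the first m, because c₀ᵐ = 1, so the two halves
      -- cancel modulo 2.
      parity-relator : ∀ t → parity (relator i j) t ≡ false
      parity-relator t = ≡.trans (parity-power m t) (≡.trans (orbitParity-+ m m (gen i) t)
        (≡.trans (cong (orbitParity m (gen i) t xor_) (orbitParity-cong m t
            (≈-trans (∙-congʳ (relations i j)) (identityˡ _))))
          (Bool.xor-same (orbitParity m (gen i) t))))
        where
        m : ℕ
        m = CoxeterMatrix.M coxeterMatrix i j

    -- The relator has even parity, and since its value is 1, conjugating by it leaves `t′`
    -- unchanged for the letters of `v`.
    parity-⇝ : ∀ {u v} → u ⇝ v → ∀ t → parity u t ≡ parity v t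
    parity-⇝ (delete u i j v) t = ≡.trans (parity-++ u (relator i j ++ v) t)
      (≡.trans (cong (parity u t xor_) step) (≡.sym (parity-++ u v t)))
      where
      t′ = unwind u t
      unwind-relator : unwind (relator i j) t′ ≈ t′
      unwind-relator = begin
        unwind (relator i j) t′                         ≈⟨ identityˡ _ ⟨
        1# ∙ unwind (relator i j) t′                    ≈⟨ ∙-congʳ (relations i j) ⟨
        eval (relator i j) ∙ unwind (relator i j) t′    ≈⟨ unwind-eval (relator i j) t′ ⟩
        t′ ∙ eval (relator i j)                         ≈⟨ ∙-congˡ (relations i j) ⟩
        t′ ∙ 1#                                         ≈⟨ identityʳ t′ ⟩
        t′                                              ∎
      step : parity (relator i j ++ v) t′ ≡ parity v t′
      step = ≡.trans (parity-++ (relator i j) v t′)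
        (cong₂ _xor_ (Dihedral.parity-relator i j t′) (parity-cong v unwind-relator))

    -- The presentation enters here: words of equal value are joined by deletions and insertions of
    -- relators.
    parity-eval : ∀ u v → eval u ≈ eval v → ∀ t → parity u t ≡ parity v t
    parity-eval u v eq t =
      EqClosure.gfold ≡.isEquivalence (λ w → parity w t) (λ r → parity-⇝ r t) (presents u v eq)

-- Subsets of positions and changes at one or two positions.

private
  variable
    m : ℕ

lookup-ext : ∀ {a} {A : Set a} (xs ys : Vec A m) → (∀ k → lookup xs k ≡ lookup ys k) → xs ≡ ys
lookup-ext xs ys eq =
  ≡.trans (≡.sym (tabulate∘lookup xs)) (≡.trans (tabulate-cong eq) (tabulate∘lookup ys))

p-x≡p[x]≔outside : (p : Subset m) (x : Fin m) → p - x ≡ p [ x ]≔ outside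
p-x≡p[x]≔outside (_ ∷ p) zero    = cong (outside ∷_) (p─⊥≡p p)
p-x≡p[x]≔outside (b ∷ p) (suc x) = cong (b ∷_) (p-x≡p[x]≔outside p x)

lookup-p-x-x : (p : Subset m) (x : Fin m) → lookup (p - x) x ≡ outside
lookup-p-x-x p x rewrite p-x≡p[x]≔outside p x = lookup∘update x p outside

lookup-p-x : (p : Subset m) {x k : Fin m} → k ≢ x → lookup (p - x) k ≡ lookup p k
lookup-p-x p {x} k≢x rewrite p-x≡p[x]≔outside p x = lookup∘update′ k≢x p outside

toggle : Subset m → Fin m → Subset m
toggle I k = updateAt I k not

-- Negating membership instead of assigning it lets one operation serve both for a flip, with one
-- position in `I` and one outside, and for the deletion of two letters, with both outside.
swap : Subset m → Fin m → Fin m → Subset m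
swap I i j = toggle (toggle I i) j

lookup-swap : (I : Subset m) {i j k : Fin m} → k ≢ i → k ≢ j → lookup (swap I i j) k ≡ lookup I k
lookup-swap I {i} {j} {k} k≢i k≢j =
  ≡.trans (lookup∘updateAt′ k j k≢j (toggle I i)) (lookup∘updateAt′ k i k≢i I)

lookup-swap-removed : (I : Subset m) {i j : Fin m} → i ≢ j → lookup (swap I i j) i ≡ not (lookup I i)
lookup-swap-removed I {i} {j} i≢j =
  ≡.trans (lookup∘updateAt′ i j i≢j (toggle I i)) (lookup∘updateAt i I)

lookup-swap-inserted : (I : Subset m) {i j : Fin m} → i ≢ j → lookup (swap I i j) j ≡ not (lookup I j)
lookup-swap-inserted I {i} {j} i≢j =
  ≡.trans (lookup∘updateAt j (toggle I i)) (cong not (lookup∘updateAt′ j i (i≢j ∘ ≡.sym) I))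

-- Roots of positions and how toggling a position changes the value of a word.

module Roots {c ℓ} (C : CoxeterSystem c ℓ) where

  open CoxeterSystem C
  open Inversions C public
  open import Algebra.Properties.Group group using (∙-cancelʳ)

  Letters : ℕ → Set
  Letters = Vec (Fin rank)

  word : Subset m → Letters m → Word
  word I Q = select (∁ I) Q

  -- p qₖ p⁻¹, where p is the product of the letters of Q before k outside I.
  root : Subset m → Letters m → Fin m → Carrier
  root (_       ∷ I) (q ∷ Q) zero    = gen q
  root (inside  ∷ I) (q ∷ Q) (suc k) = root I Q k
  root (outside ∷ I) (q ∷ Q) (suc k) = conj q (root I Q k)

  conj-gen : ∀ i x y → conj i x ∙ (gen i ∙ y) ≈ gen i ∙ (x ∙ y)
  conj-gen i x y = begin
    gen i ∙ x ∙ gen i ∙ (gen i ∙ y)    ≈⟨ assoc _ _ _ ⟩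
    gen i ∙ x ∙ (gen i ∙ (gen i ∙ y))  ≈⟨ ∙-congˡ (gen-cancelˡ i y) ⟩
    gen i ∙ x ∙ y                      ≈⟨ assoc _ _ _ ⟩
    gen i ∙ (x ∙ y)                    ∎

  root² : (I : Subset m) (Q : Letters m) (k : Fin m) → root I Q k ∙ root I Q k ≈ 1#
  root² (_       ∷ I) (q ∷ Q) zero    = gen² q
  root² (inside  ∷ I) (q ∷ Q) (suc k) = root² I Q k
  root² (outside ∷ I) (q ∷ Q) (suc k) = begin
    conj q r ∙ (gen q ∙ r ∙ gen q)    ≈⟨ ∙-congˡ (assoc _ _ _) ⟩
    conj q r ∙ (gen q ∙ (r ∙ gen q))  ≈⟨ conj-gen q r _ ⟩
    gen q ∙ (r ∙ (r ∙ gen q))         ≈⟨ ∙-congˡ (assoc _ _ _) ⟨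
    gen q ∙ (r ∙ r ∙ gen q)           ≈⟨ ∙-congˡ (∙-congʳ (root² I Q k)) ⟩
    gen q ∙ (1# ∙ gen q)              ≈⟨ ∙-congˡ (identityˡ _) ⟩
    gen q ∙ gen q                     ≈⟨ gen² q ⟩
    1#                                ∎
    where
    r : Carrier
    r = root I Q k

  root-agree : (I N : Subset m) (Q : Letters m) (i : Fin m) →
    (∀ k → k < i → lookup I k ≡ lookup N k) → root I Q i ≡ root N Q i
  root-agree (_ ∷ I) (_ ∷ N) (q ∷ Q) zero    eq = refl
  root-agree (b ∷ I) (b′ ∷ N) (q ∷ Q) (suc i) eq with b | b′ | eq zero (s≤s z≤n)
  ... | inside  | .inside  | refl = root-agree I N Q i (λ k k<i → eq (suc k) (s≤s k<i))
  ... | outside | .outside | refl = cong (conj q) (root-agree I N Q i (λ k k<i → eq (suc k) (s≤s k<i)))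

  -- The conjugate w⁻¹ r w of the root r by the value w of the word of I; unlike r,
  -- it depends only on the positions after k.
  coroot : Subset m → Letters m → Fin m → Carrier
  coroot (_ ∷ I) (q ∷ Q) zero    = eval (word I Q) ⁻¹ ∙ (gen q ∙ eval (word I Q))
  coroot (_ ∷ I) (q ∷ Q) (suc k) = coroot I Q k

  coroot-agree : (I N : Subset m) (Q : Letters m) (i : Fin m) →
    (∀ k → i < k → lookup I k ≡ lookup N k) → coroot I Q i ≡ coroot N Q i
  coroot-agree (_ ∷ I) (_ ∷ N) (q ∷ Q) zero    eq =
    cong (λ J → eval (word J Q) ⁻¹ ∙ (gen q ∙ eval (word J Q)))
         (lookup-ext I N (λ k → eq (suc k) (s≤s z≤n)))
  coroot-agree (_ ∷ I) (_ ∷ N) (q ∷ Q) (suc i) eq =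
    coroot-agree I N Q i (λ k i<k → eq (suc k) (s≤s i<k))

  -- Letters before `k` are carried along by `conj-gen`. The letter at `k` commutes with itself, so
  -- one identity serves whether or not it belongs to the word.
  root-coroot : (I : Subset m) (Q : Letters m) (k : Fin m) →
    root I Q k ∙ eval (word I Q) ≈ eval (word I Q) ∙ coroot I Q k
  root-coroot (b ∷ I) (q ∷ Q) zero = at b
    where
    w : Carrier
    w = eval (word I Q)
    at-inside : gen q ∙ w ≈ w ∙ (w ⁻¹ ∙ (gen q ∙ w))
    at-inside = begin
      gen q ∙ w                    ≈⟨ identityˡ _ ⟨
      1# ∙ (gen q ∙ w)             ≈⟨ ∙-congʳ (inverseʳ w) ⟨
      w ∙ w ⁻¹ ∙ (gen q ∙ w)       ≈⟨ assoc _ _ _ ⟩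
      w ∙ (w ⁻¹ ∙ (gen q ∙ w))     ∎
    at : ∀ b → gen q ∙ eval (word (b ∷ I) (q ∷ Q))
             ≈ eval (word (b ∷ I) (q ∷ Q)) ∙ (w ⁻¹ ∙ (gen q ∙ w))
    at inside  = at-inside
    at outside = ≈-trans (∙-congˡ at-inside) (≈-sym (assoc _ _ _))
  root-coroot (inside  ∷ I) (q ∷ Q) (suc k) = root-coroot I Q k
  root-coroot (outside ∷ I) (q ∷ Q) (suc k) = begin
    conj q (root I Q k) ∙ (gen q ∙ eval (word I Q))  ≈⟨ conj-gen q _ _ ⟩
    gen q ∙ (root I Q k ∙ eval (word I Q))           ≈⟨ ∙-congˡ (root-coroot I Q k) ⟩
    gen q ∙ (eval (word I Q) ∙ coroot I Q k)         ≈⟨ assoc _ _ _ ⟨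
    gen q ∙ eval (word I Q) ∙ coroot I Q k           ∎

  -- Agreement after `i` gives equal coroots, and the common value of the words converts these back
  -- into roots.
  root-coagree : (I N : Subset m) (Q : Letters m) (i : Fin m) →
    eval (word I Q) ≈ eval (word N Q) → (∀ k → i < k → lookup I k ≡ lookup N k) →
    root I Q i ≈ root N Q i
  root-coagree I N Q i I≈N eq = ∙-cancelʳ (eval (word N Q)) _ _ (begin
    root I Q i ∙ eval (word N Q)    ≈⟨ ∙-congˡ I≈N ⟨
    root I Q i ∙ eval (word I Q)    ≈⟨ root-coroot I Q i ⟩
    eval (word I Q) ∙ coroot I Q i  ≈⟨ ∙-cong I≈N (≈-reflexive (coroot-agree I N Q i eq)) ⟩
    eval (word N Q) ∙ coroot N Q i  ≈⟨ root-coroot N Q i ⟨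
    root N Q i ∙ eval (word N Q)    ∎)

  -- Inserting qₖ after a prefix p is left multiplication by p qₖ p⁻¹; this is an involution, so
  -- deleting qₖ is the same multiplication.
  eval-toggle : (I : Subset m) (Q : Letters m) (k : Fin m) →
    eval (word (toggle I k) Q) ≈ root I Q k ∙ eval (word I Q)
  eval-toggle (inside  ∷ I) (q ∷ Q) zero    = ≈-refl
  eval-toggle (outside ∷ I) (q ∷ Q) zero    = ≈-sym (gen-cancelˡ q _)
  eval-toggle (inside  ∷ I) (q ∷ Q) (suc k) = eval-toggle I Q k
  eval-toggle (outside ∷ I) (q ∷ Q) (suc k) =
    ≈-trans (∙-congˡ (eval-toggle I Q k)) (≈-sym (conj-gen q _ _))

  -- The later position is toggled first, which does not affect the root at the earlier one.
  eval-swap-> : (I : Subset m) (Q : Letters m) {i j : Fin m} → j < i →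
    eval (word (swap I i j) Q) ≈ root I Q j ∙ (root I Q i ∙ eval (word I Q))
  eval-swap-> I Q {i} {j} j<i = begin
    eval (word (swap I i j) Q)                        ≈⟨ eval-toggle (toggle I i) Q j ⟩
    root (toggle I i) Q j ∙ eval (word (toggle I i) Q)
      ≈⟨ ∙-cong (≈-reflexive (root-agree (toggle I i) I Q j unchanged)) (eval-toggle I Q i) ⟩
    root I Q j ∙ (root I Q i ∙ eval (word I Q))       ∎
    where
    unchanged : ∀ k → k < j → lookup (toggle I i) k ≡ lookup I k
    unchanged k k<j = lookup∘updateAt′ k i (Fin.<⇒≢ (Fin.<-trans k<j j<i)) I

  -- The value is multiplied on the left by a product of two involutions, which is trivial exactly
  -- when they are equal.
  swap-eval⇔-> : (I : Subset m) (Q : Letters m) {i j : Fin m} → j < i →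
    eval (word (swap I i j) Q) ≈ eval (word I Q) ⇔ root I Q i ≈ root I Q j
  swap-eval⇔-> I Q {i} {j} j<i = mk⇔
    (λ eq → ∙-cancelʳ w _ _ (begin
      s ∙ w              ≈⟨ r-cancel (s ∙ w) ⟨
      r ∙ (r ∙ (s ∙ w))  ≈⟨ ∙-congˡ (≈-trans (≈-sym (eval-swap-> I Q j<i)) eq) ⟩
      r ∙ w              ∎))
    (λ s≈r → begin
      eval (word (swap I i j) Q)  ≈⟨ eval-swap-> I Q j<i ⟩
      r ∙ (s ∙ w)                 ≈⟨ ∙-congˡ (∙-congʳ s≈r) ⟩
      r ∙ (r ∙ w)                 ≈⟨ r-cancel w ⟩
      w                           ∎)
    where
    r s w : Carrier
    r = root I Q j
    s = root I Q i
    w = eval (word I Q)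
    r-cancel : ∀ x → r ∙ (r ∙ x) ≈ x
    r-cancel x = begin
      r ∙ (r ∙ x)  ≈⟨ assoc _ _ _ ⟨
      r ∙ r ∙ x    ≈⟨ ∙-congʳ (root² I Q j) ⟩
      1# ∙ x       ≈⟨ identityˡ x ⟩
      x            ∎

  swap-eval⇔ : (I : Subset m) (Q : Letters m) {i j : Fin m} → i ≢ j →
    eval (word (swap I i j) Q) ≈ eval (word I Q) ⇔ root I Q i ≈ root I Q j
  swap-eval⇔ I Q {i} {j} i≢j with Fin.<-cmp i j
  ... | tri≈ _ i≡j _ = contradiction i≡j i≢j
  ... | tri> _ _ j<i = swap-eval⇔-> I Q j<i
  ... | tri< i<j _ _ = mk⇔
    (λ eq → ≈-sym (to (≈-trans (≈-reflexive (cong (λ J → eval (word J Q)) commutes)) eq)))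
    (λ eq → ≈-trans (≈-reflexive (cong (λ J → eval (word J Q)) (≡.sym commutes))) (from (≈-sym eq)))
    where
    open Equivalence (swap-eval⇔-> I Q i<j)
    commutes : swap I j i ≡ swap I i j
    commutes = updateAt-commutes i j i≢j I

  length-toggle-inside : (I : Subset m) (Q : Letters m) (k : Fin m) → lookup I k ≡ inside →
    length (word (toggle I k) Q) ≡ ℕ.suc (length (word I Q))
  length-toggle-inside (inside  ∷ I) (q ∷ Q) zero    _  = refl
  length-toggle-inside (inside  ∷ I) (q ∷ Q) (suc k) eq = length-toggle-inside I Q k eq
  length-toggle-inside (outside ∷ I) (q ∷ Q) (suc k) eq = cong ℕ.suc (length-toggle-inside I Q k eq)

  length-toggle-outside : (I : Subset m) (Q : Letters m) (k : Fin m) → lookup I k ≡ outside →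
    ℕ.suc (length (word (toggle I k) Q)) ≡ length (word I Q)
  length-toggle-outside (outside ∷ I) (q ∷ Q) zero    _  = refl
  length-toggle-outside (inside  ∷ I) (q ∷ Q) (suc k) eq = length-toggle-outside I Q k eq
  length-toggle-outside (outside ∷ I) (q ∷ Q) (suc k) eq = cong ℕ.suc (length-toggle-outside I Q k eq)

  module RootParity (_≟_ : Decidable _≈_) where

    open Parity _≟_

    parity⇒root : (I : Subset m) (Q : Letters m) (t : Carrier) → parity (word I Q) t ≡ true →
      ∃[ j ] (lookup I j ≡ outside × root I Q j ≈ t)
    parity⇒root [] [] t ()
    parity⇒root (inside ∷ I) (q ∷ Q) t odd with parity⇒root I Q t odd
    ... | j , out , eq = suc j , out , eq
    parity⇒root (outside ∷ I) (q ∷ Q) t odd with gen q ≟ t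
    ... | yes eq = zero , refl , eq
    ... | no  _  with parity⇒root I Q (conj q t) odd
    ...   | j , out , eq = suc j , out , ≈-sym (conj-swap q (≈-sym eq))

    unique-root⇒parity : (I : Subset m) (Q : Letters m) {t : Carrier} (i : Fin m) →
      lookup I i ≡ outside → root I Q i ≈ t →
      (∀ j → lookup I j ≡ outside → root I Q j ≈ t → j ≡ i) → parity (word I Q) t ≡ true
    unique-root⇒parity (outside ∷ I) (q ∷ Q) {t} zero _ eq unique with gen q ≟ t
    ... | no  neq = contradiction eq neq
    ... | yes _   with parity (word I Q) (conj q t) in odd
    ...   | false = refl
    -- An odd count in the tail would give a second position with root `t`, against uniqueness.
    ...   | true  with parity⇒root I Q (conj q t) odd
    ...     | j , out , eq′ with unique (suc j) out (≈-sym (conj-swap q (≈-sym eq′)))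
    ...       | ()
    unique-root⇒parity (inside ∷ I) (q ∷ Q) (suc i) out eq unique =
      unique-root⇒parity I Q i out eq
        (λ j out′ eq′ → Fin.suc-injective (unique (suc j) out′ eq′))
    unique-root⇒parity (outside ∷ I) (q ∷ Q) {t} (suc i) out eq unique with gen q ≟ t
    ... | yes eq′ with unique zero refl eq′
    ...   | ()
    unique-root⇒parity (outside ∷ I) (q ∷ Q) {t} (suc i) out eq unique | no _ =
      unique-root⇒parity I Q i out (conj-swap q eq)
        (λ j out′ eq′ → Fin.suc-injective (unique (suc j) out′ (≈-sym (conj-swap q (≈-sym eq′)))))

∈─ : ∀ {m} (p q : Subset m) {x} → lookup p x ≡ inside → lookup q x ≡ outside → x ∈ p ─ q
∈─ p q {x} x∈p x∉q = x∈p∧x∉q⇒x∈p─q (lookup⇒[]= x p x∈p)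
  (λ x∈q → contradiction (≡.trans (≡.sym x∉q) ([]=⇒lookup x∈q)) (λ ()))

∈─⇒≢ : ∀ {m} (p q : Subset m) {x} → x ∈ p ─ q → lookup p x ≢ lookup q x
∈─⇒≢ (inside ∷ p) (outside ∷ q) here          ()
∈─⇒≢ (_ ∷ p)      (inside  ∷ q) (there x∈p─q) = ∈─⇒≢ p q x∈p─q
∈─⇒≢ (_ ∷ p)      (outside ∷ q) (there x∈p─q) = ∈─⇒≢ p q x∈p─q

-- Serves the source tree, whose paths are built backwards from their end, so that the labels first
-- come in decreasing order.
reverse-rising : ∀ {m} {is : List (Fin m)} → AllPairs (flip _<_) is → AllPairs _<_ (reverse is)
reverse-rising {is = []}     []                = []
reverse-rising {is = i ∷ is} (is<i ∷ falling) = ≡.subst (AllPairs _<_) (≡.sym (unfold-reverse i is))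
  (AllPairs.++⁺ (reverse-rising falling) ([] ∷ []) 
    (All.tabulate (λ j∈is → All.lookup is<i (Any.reverse⁻ j∈is) ∷ [])))

-- Facets, flips and the exchange property.

module Facets {c ℓ} (C : CoxeterSystem c ℓ) (_≟_ : Decidable (CoxeterSystem._≈_ C))
              {m} (Q : Vec (Fin (CoxeterSystem.rank C)) m) (ρ : CoxeterSystem.Carrier C) where

  open CoxeterSystem C
  open SubwordComplex C Q ρ
  open Roots C
  open Parity _≟_
  open RootParity _≟_
  open Adjacent

  -- A record, so that I can be inferred from a proof.
  record Facet (I : Subset m) : Set ℓ where
    constructor facet
    field
      isFacet : IsFacet I

  source : ∀ {I J} → Adjacent I J → Facet I
  source a = facet (facetˡ a)

  target : ∀ {I J} → Adjacent I J → Facet J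
  target a = facet (facetʳ a)

  facet-eval : ∀ {I N} → Facet I → Facet N → eval (word I Q) ≈ eval (word N Q)
  facet-eval (facet (I≈ρ , _)) (facet (N≈ρ , _)) = ≈-trans I≈ρ (≈-sym N≈ρ)

  -- Equal roots preserve the value, and trading a position in `I` for one outside preserves the
  -- length, so the new word is again reduced.
  swap-facet : ∀ {I i j} → Facet I → lookup I i ≡ inside → lookup I j ≡ outside →
    root I Q i ≈ root I Q j → i ≢ j × Facet (swap I i j)
  swap-facet {I} {i} {j} (facet (I≈ρ , _ , shortest)) i∈I j∉I eq =
    i≢j , facet (J≈ρ , (word (swap I i j) Q , J≈ρ , refl) ,
    λ u u≈ρ → ≡.subst (ℕ._≤ length u) (≡.sym same-length) (shortest u u≈ρ))
    where
    i≢j : i ≢ j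
    i≢j refl with ≡.trans (≡.sym i∈I) j∉I
    ... | ()
    J≈ρ : eval (word (swap I i j) Q) ≈ ρ
    J≈ρ = ≈-trans (Equivalence.from (swap-eval⇔ I Q i≢j) eq) I≈ρ
    same-length : length (word (swap I i j) Q) ≡ length (word I Q)
    same-length = ℕ.suc-injective (≡.trans
      (length-toggle-outside (toggle I i) Q j (≡.trans (lookup∘updateAt′ j i (i≢j ∘ ≡.sym) I) j∉I))
      (length-toggle-inside I Q i i∈I))

  -- Two equal reflections could be deleted together, leaving a shorter expression.
  root-injective : ∀ {I i j} → Facet I → lookup I i ≡ outside → lookup I j ≡ outside →
    root I Q i ≈ root I Q j → i ≡ j
  root-injective {I} {i} {j} (facet (I≈ρ , _ , shortest)) i∉I j∉I eq with i Fin.≟ j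
  ... | yes i≡j = i≡j
  ... | no  i≢j = contradiction
    (shortest (word (swap I i j) Q) (≈-trans (Equivalence.from (swap-eval⇔ I Q i≢j) eq) I≈ρ))
    (ℕ.<⇒≱ (ℕ.≤-trans (ℕ.n≤1+n _) (ℕ.≤-reflexive (≡.trans
      (cong ℕ.suc (length-toggle-outside (toggle I i) Q j
        (≡.trans (lookup∘updateAt′ j i (i≢j ∘ ≡.sym) I) j∉I)))
      (length-toggle-outside I Q i i∉I)))))

  -- Roots outside a facet are distinct, so this reflection occurs exactly once along the word of
  -- `N`. Its parity is then odd along the word of `I` too, and some letter of that word carries it.
  exchange-root : ∀ {I N i} → Facet I → Facet N → lookup N i ≡ outside →
    root I Q i ≈ root N Q i → ∃[ j ] (lookup I j ≡ outside × root I Q j ≈ root I Q i)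
  exchange-root {I} {N} {i} I-facet N-facet i∉N eq = parity⇒root I Q (root I Q i)
    (≡.trans (parity-eval (word I Q) (word N Q) (facet-eval I-facet N-facet) (root I Q i))
      (unique-root⇒parity N Q i i∉N (≈-sym eq)
        (λ j j∉N eq′ → root-injective N-facet j∉N i∉N (≈-trans eq′ eq))))

  adjacent-sym : ∀ {I J} → Adjacent I J → Adjacent J I
  adjacent-sym a = record
    { facetˡ = facetʳ a ; facetʳ = facetˡ a ; distinct = distinct a ∘ ≡.sym
    ; removed = inserted a ; inserted = removed a
    ; removed∈ = inserted∈ a ; inserted∈ = removed∈ a ; exchange = ≡.sym (exchange a) }

  adjacent-lookup : ∀ {I J k} (a : Adjacent I J) → k ≢ removed a → k ≢ inserted a →
    lookup I k ≡ lookup J k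
  adjacent-lookup {I} {J} {k} a k≢i k≢j =
    ≡.trans (≡.sym (lookup-p-x I k≢i))
      (≡.trans (cong (λ X → lookup X k) (exchange a)) (lookup-p-x J k≢j))

  removed≢inserted : ∀ {I J} (a : Adjacent I J) → removed a ≢ inserted a
  removed≢inserted {I} {J} a i≡j = distinct a (lookup-ext I J same)
    where
    same : ∀ k → lookup I k ≡ lookup J k
    same k with k Fin.≟ removed a
    ... | no k≢i  = adjacent-lookup a k≢i (λ k≡j → k≢i (≡.trans k≡j (≡.sym i≡j)))
    ... | yes refl = ≡.trans ([]=⇒lookup (removed∈ a))
                       (≡.sym (≡.subst (λ k → lookup J k ≡ inside) (≡.sym i≡j) ([]=⇒lookup (inserted∈ a))))

  removed∉ : ∀ {I J} (a : Adjacent I J) → lookup J (removed a) ≡ outside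
  removed∉ {I} {J} a = ≡.trans (≡.sym (lookup-p-x J (removed≢inserted a)))
    (≡.trans (cong (λ X → lookup X (removed a)) (≡.sym (exchange a))) (lookup-p-x-x I (removed a)))

  adjacent⇒swap : ∀ {I J} (a : Adjacent I J) → J ≡ swap I (removed a) (inserted a)
  adjacent⇒swap {I} {J} a = lookup-ext J (swap I (removed a) (inserted a)) same
    where
    i≢j = removed≢inserted a
    same : ∀ k → lookup J k ≡ lookup (swap I (removed a) (inserted a)) k
    same k with k Fin.≟ removed a | k Fin.≟ inserted a
    ... | yes refl | _ = ≡.trans (removed∉ a)
      (≡.sym (≡.trans (lookup-swap-removed I i≢j) (cong not ([]=⇒lookup (removed∈ a)))))
    ... | no _     | yes refl = ≡.trans ([]=⇒lookup (inserted∈ a))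
      (≡.sym (≡.trans (lookup-swap-inserted I i≢j) (cong not (removed∉ (adjacent-sym a)))))
    ... | no k≢i   | no k≢j =
      ≡.trans (≡.sym (adjacent-lookup a k≢i k≢j)) (≡.sym (lookup-swap I k≢i k≢j))

  swap-adjacent : ∀ {I i j} → Facet I → lookup I i ≡ inside → lookup I j ≡ outside →
    root I Q i ≈ root I Q j → Adjacent I (swap I i j)
  swap-adjacent {I} {i} {j} I-facet i∈I j∉I eq = record
    { facetˡ = Facet.isFacet I-facet ; facetʳ = Facet.isFacet J-facet
    ; distinct = λ I≡J → contradiction
        (≡.trans (≡.sym i∉J) (≡.trans (cong (λ X → lookup X i) (≡.sym I≡J)) i∈I)) (λ ())
    ; removed = i ; inserted = j
    ; removed∈ = lookup⇒[]= i I i∈I ; inserted∈ = lookup⇒[]= j (swap I i j) j∈J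
    ; exchange = lookup-ext (I - i) (swap I i j - j) same }
    where
    i≢j = proj₁ (swap-facet I-facet i∈I j∉I eq)
    J-facet = proj₂ (swap-facet I-facet i∈I j∉I eq)
    i∉J : lookup (swap I i j) i ≡ outside
    i∉J = ≡.trans (lookup-swap-removed I i≢j) (cong not i∈I)
    j∈J : lookup (swap I i j) j ≡ inside
    j∈J = ≡.trans (lookup-swap-inserted I i≢j) (cong not j∉I)
    same : ∀ k → lookup (I - i) k ≡ lookup (swap I i j - j) k
    same k with k Fin.≟ i | k Fin.≟ j
    ... | yes refl | _ = ≡.trans (lookup-p-x-x I i) (≡.sym (≡.trans (lookup-p-x (swap I i j) i≢j) i∉J))
    ... | no k≢i | yes refl = ≡.trans (lookup-p-x I k≢i) (≡.trans j∉I (≡.sym (lookup-p-x-x (swap I i j) j)))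
    ... | no k≢i | no k≢j = ≡.trans (lookup-p-x I k≢i)
      (≡.sym (≡.trans (lookup-p-x (swap I i j) k≢j) (lookup-swap I k≢i k≢j)))

  adjacent-root : ∀ {I J} (a : Adjacent I J) → root I Q (removed a) ≈ root I Q (inserted a)
  adjacent-root {I} a = Equivalence.to (swap-eval⇔ I Q (removed≢inserted a))
    (≡.subst (λ X → eval (word X Q) ≈ eval (word I Q)) (adjacent⇒swap a)
      (facet-eval (target a) (source a)))

  -- The inserted position lies outside `I` and has the root of the removed one; by `root-injective`
  -- there is only one such position.
  flip-unique : ∀ {I J K} (a : Adjacent I J) (b : Adjacent I K) → removed a ≡ removed b → J ≡ K
  flip-unique {I} a b i≡i′ = ≡.trans (adjacent⇒swap a)
    (≡.trans (cong₂ (swap I) i≡i′ j≡j′) (≡.sym (adjacent⇒swap b)))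
    where
    j≡j′ : inserted a ≡ inserted b
    j≡j′ = root-injective (source a) (removed∉ (adjacent-sym a)) (removed∉ (adjacent-sym b))
      (≈-trans (≈-sym (adjacent-root a))
        (≈-trans (≈-reflexive (cong (root I Q) i≡i′)) (adjacent-root b)))

  -- Rising chains of flips for an abstract order on positions, covering both reading directions.

  module Directed
    {_≺_ : Rel (Fin m) 0ℓ} (isSTO : IsStrictTotalOrder _≡_ _≺_)
    (wellFounded : WellFounded _≺_) (noetherian : WellFounded (flip _≺_))
    (roots-agree : ∀ {I N i} → Facet I → Facet N →
      (∀ k → k ≺ i → lookup I k ≡ lookup N k) → root I Q i ≈ root N Q i) where

    open IsStrictTotalOrder isSTO using (compare; _<?_; asym) renaming (trans to ≺-trans; irrefl to ≺-irrefl)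

    -- i is the ≺-first position at which I and N differ, and it lies in I.
    record Leaves (I N : Subset m) (i : Fin m) : Set where
      constructor leaving
      field
        before : ∀ k → k ≺ i → lookup I k ≡ lookup N k
        i∈I    : lookup I i ≡ inside
        i∉N    : lookup N i ≡ outside

    leaves-unique : ∀ {I N i i′} → Leaves I N i → Leaves I N i′ → i ≡ i′
    leaves-unique {i = i} {i′} (leaving same i∈I i∉N) (leaving same′ i′∈I i′∉N) with compare i i′
    ... | tri≈ _ i≡i′ _ = i≡i′
    ... | tri< i≺i′ _ _ = contradiction (≡.trans (≡.sym i∈I) (≡.trans (same′ i i≺i′) i∉N)) (λ ())
    ... | tri> _ _ i′≺i = contradiction (≡.trans (≡.sym i′∈I) (≡.trans (same i′ i′≺i) i′∉N)) (λ ())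

    -- The flip changes nothing before the removed position, and `J` already agrees with `N` up to
    -- and including it.
    leaves-step : ∀ {I J N} (a : Adjacent I J) → removed a ≺ inserted a →
      (∀ k → ¬ (removed a ≺ k) → lookup J k ≡ lookup N k) → Leaves I N (removed a)
    leaves-step a i≺j same = leaving
      (λ k k≺i → ≡.trans
        (adjacent-lookup a (λ k≡i → ≺-irrefl k≡i k≺i) (λ k≡j → ≺-irrefl k≡j (≺-trans k≺i i≺j)))
        (same k (asym k≺i)))
      ([]=⇒lookup (removed∈ a))
      (≡.trans (≡.sym (same (removed a) (≺-irrefl refl))) (removed∉ a))

    -- The flip settles the removed position and disturbs nothing before it. This makes the labels
    -- rise and the construction of the chain terminate.
    leaves-later : ∀ {I J N i} (a : Adjacent I J) → removed a ≺ inserted a →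
      Leaves I N (removed a) → Leaves J N i → removed a ≺ i
    leaves-later {i = i} a i≺j (leaving same _ _) (leaving _ i∈J i∉N) with compare (removed a) i
    ... | tri< r≺i _ _    = r≺i
    ... | tri≈ _ refl _   = contradiction (≡.trans (≡.sym i∈J) (removed∉ a)) (λ ())
    ... | tri> _ r≢i i≺r = contradiction
      (≡.trans (≡.sym i∈J) (≡.trans
        (≡.sym (adjacent-lookup a (r≢i ∘ ≡.sym) (λ i≡j → ≺-irrefl i≡j (≺-trans i≺r i≺j))))
        (≡.trans (same i i≺r) i∉N)))
      (λ ())

    exchange-flip : ∀ {I N i} → Facet I → Facet N → Leaves I N i →
      ∃[ J ] ∃[ a ] (removed {I} {J} a ≡ i × removed a ≺ inserted a)
    exchange-flip {I} {N} {i} I-facet N-facet (leaving same i∈I i∉N)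
      with exchange-root I-facet N-facet i∉N (roots-agree I-facet N-facet same)
    ... | j , j∉I , eq = _ , swap-adjacent I-facet i∈I j∉I (≈-sym eq) , refl , i≺j
      where
      i≺j : i ≺ j
      i≺j with compare i j
      ... | tri< i≺j _ _ = i≺j
      ... | tri≈ _ refl _ = contradiction (≡.trans (≡.sym i∈I) j∉I) (λ ())
      -- Before `i` the facets agree, so `j` would lie outside `N` and have the same root there as
      -- `i`, contradicting `root-injective` for `N`.
      ... | tri> _ i≢j j≺i = contradiction
        (≡.sym (root-injective N-facet (≡.trans (≡.sym (same j j≺i)) j∉I) i∉N
          (≈-trans (≈-sym (roots-agree I-facet N-facet (λ k k≺j → same k (≺-trans k≺j j≺i))))
            (≈-trans eq (roots-agree I-facet N-facet same)))))
        i≢j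

    -- Kept apart from `Star _⟶_` because for the reversed order a chain runs against the edges of
    -- the flip graph. The index records the removed positions.
    data Chain (N : Subset m) : Subset m → List (Fin m) → Set ℓ where
      []  : Chain N N []
      _∷_ : ∀ {I J is} (e : ∃[ a ] removed {I} {J} a ≺ inserted a) → Chain N J is →
            Chain N I (removed (proj₁ e) ∷ is)

    module _ {N} (N-facet : Facet N)
             (greedy : ∀ {J} (a : Adjacent N J) → ¬ (removed a ≺ inserted a)) where

      Differs : Subset m → Fin m → Set
      Differs I k = lookup I k ≢ lookup N k

      first-difference : ∀ {I k} → Acc _≺_ k → Differs I k →
        ∃[ i ] (Differs I i × (∀ k → k ≺ i → lookup I k ≡ lookup N k))
      first-difference {I} {k} (acc rec) differs
        with Fin.any? (λ l → (l <? k) ×-dec ¬? (lookup I l Bool.≟ lookup N l))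
      ... | yes (l , l≺k , differs′) = first-difference {I} (rec l≺k) differs′
      ... | no  none = k , differs , λ l l≺k → decidable-stable (lookup I l Bool.≟ lookup N l)
        (λ differs′ → none (l , l≺k , differs′))

      -- If the first difference belonged to `N` instead of `I`, `exchange-flip` with the facets
      -- interchanged would flip it out of `N`, against greediness.
      leaves : ∀ {I} → Facet I → I ≢ N → ∃[ i ] Leaves I N i
      leaves {I} I-facet I≢N with Fin.any? (λ k → ¬? (lookup I k Bool.≟ lookup N k))
      ... | no same = contradiction
        (lookup-ext I N (λ k → decidable-stable (lookup I k Bool.≟ lookup N k) (λ d → same (k , d)))) I≢N
      ... | yes (k , differs) with first-difference {I} (wellFounded k) differs
      ...   | i , differs′ , same with lookup I i in eqI | lookup N i in eqN
      ...     | inside  | inside  = contradiction refl differs′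
      ...     | outside | outside = contradiction refl differs′
      ...     | inside  | outside = i , leaving same eqI eqN
      ...     | outside | inside  with exchange-flip N-facet I-facet (leaving (λ k k≺i → ≡.sym (same k k≺i)) eqN eqI)
      ...       | _ , a , _ , i≺j = contradiction i≺j (greedy a)

      -- Flipping the first difference again and again moves it strictly onward by `leaves-later`,
      -- so the recursion is well-founded and its labels rise.
      chain-from : ∀ {I i} → Facet I → Leaves I N i → Acc (flip _≺_) i →
        ∃[ is ] (Chain N I (i ∷ is) × AllPairs _≺_ (i ∷ is))
      chain-from {I} {i} I-facet leaves-i (acc rec)
        with exchange-flip I-facet N-facet leaves-i
      ... | J , a , refl , i≺j with ≡-dec Bool._≟_ J N
      ...   | yes refl = [] , (a , i≺j) ∷ [] , [] ∷ []
      ...   | no J≢N with leaves (target a) J≢N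
      ...     | i′ , leaves-i′
        with i≺i′ ← leaves-later a i≺j leaves-i leaves-i′
        with chain-from (target a) leaves-i′ (rec i≺i′)
      ...       | is , π , rising@(below ∷ _) =
        i′ ∷ is , (a , i≺j) ∷ π , (i≺i′ ∷ All.map (≺-trans i≺i′) below) ∷ rising

      chain : ∀ {I} → Facet I → I ≢ N → ∃[ i ] ∃[ is ] (Chain N I (i ∷ is) × AllPairs _≺_ (i ∷ is))
      chain I-facet I≢N with leaves I-facet I≢N
      ... | i , leaves-i = i , chain-from I-facet leaves-i (noetherian i)

  module Sink = Directed Fin.<-isStrictTotalOrder <-wellFounded >-wellFounded
    (λ {I} {N} {i} _ _ same → ≈-reflexive (root-agree I N Q i same))

  -- Reversing the order turns `removed ≺ inserted` into a decreasing flip, and agreement before `i`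
  -- into agreement on a suffix.
  module Source = Directed (Flip.isStrictTotalOrder Fin.<-isStrictTotalOrder) >-wellFounded <-wellFounded
    (λ {I} {N} {i} I-facet N-facet same → root-coagree I N Q i (facet-eval I-facet N-facet) same)

  -- From chains to labelled paths in the flip graph.

  labels-◅◅ : (lab : Labelling) → ∀ {I J K} (π : Star _⟶_ I J) (π′ : Star _⟶_ J K) →
    labels lab (π ◅◅ π′) ≡ labels lab π ++ labels lab π′
  labels-◅◅ lab ε       π′ = refl
  labels-◅◅ lab (e ◅ π) π′ = cong (lab e ∷_) (labels-◅◅ lab π π′)

  sink-path : ∀ {N I is} → Sink.Chain N I is → ∃[ π ] labels 𝗉 {I} {N} π ≡ is
  sink-path Sink.[] = ε , refl
  sink-path (e Sink.∷ c) with sink-path c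
  ... | π , eq = e ◅ π , cong (𝗉 e ∷_) eq

  reverse-edge : ∀ {I J} → ∃[ a ] (inserted {I} {J} a < removed a) → J ⟶ I
  reverse-edge (a , j<i) = adjacent-sym a , j<i

  -- Each flip of the chain, taken backwards, is increasing and inserts the position that the chain
  -- removes. The signature comes first because the label computation below mentions the path.
  source-path : ∀ {P I is} → Source.Chain P I is → ∃[ π ] labels 𝗇 {P} {I} π ≡ reverse is

  labels-source-path : ∀ {P I J is} (e : ∃[ a ] (inserted {I} {J} a < removed a)) (c : Source.Chain P J is) →
    labels 𝗇 (proj₁ (source-path c) ◅◅ (reverse-edge e ◅ ε)) ≡ reverse (removed (proj₁ e) ∷ is)
  labels-source-path {is = is} e c =
    ≡.trans (labels-◅◅ 𝗇 (proj₁ (source-path c)) (reverse-edge e ◅ ε))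
      (≡.trans (cong (_++ _) (proj₂ (source-path c))) (≡.sym (unfold-reverse _ is)))

  source-path Source.[]      = ε , refl
  source-path (e Source.∷ c) = _ , labels-source-path e c

  sink-unchanged : ∀ {I N i k} (π : Star _⟶_ I N) → All (i <_) (labels 𝗉 π) → ¬ (i < k) →
    lookup I k ≡ lookup N k
  sink-unchanged ε             []            i≮k = refl
  sink-unchanged ((a , r<s) ◅ π) (i<r ∷ i<rs) i≮k = ≡.trans
    (adjacent-lookup a (λ { refl → i≮k i<r }) (λ { refl → i≮k (Fin.<-trans i<r r<s) }))
    (sink-unchanged π i<rs i≮k)

  -- In an increasing flip the removed position is below the inserted one, so a bound on the
  -- 𝗇-labels bounds every position that changes.
  source-unchanged : ∀ {P I j k} (π : Star _⟶_ P I) → All (_< j) (labels 𝗇 π) → ¬ (k < j) →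
    lookup P k ≡ lookup I k
  source-unchanged ε             []            k≮j = refl
  source-unchanged ((a , r<s) ◅ π) (s<j ∷ ss<j) k≮j = ≡.trans
    (adjacent-lookup a (λ { refl → k≮j (Fin.<-trans r<s s<j) }) (λ { refl → k≮j s<j }))
    (source-unchanged π ss<j k≮j)

  -- Later labels exceed the first, so everything up to the first label is final after one flip.
  -- Both uniqueness of the father and the description of the flip rest on this.
  sink-father-leaves : ∀ {N I J} (f : IsPositiveSinkFather N I J) → Sink.Leaves I N (𝗉 (proj₁ f))
  sink-father-leaves ((a , r<s) , π , rising) with Linked⇒AllPairs Fin.<-trans rising
  ... | r<rs ∷ _ = Sink.leaves-step a r<s (λ k → sink-unchanged π r<rs)

  all-before-last : ∀ (is : List (Fin m)) {j} → AllPairs _<_ (is ++ j ∷ []) → All (_< j) is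
  all-before-last []       _              = []
  all-before-last (i ∷ is) (i<s ∷ rising) = All.head (All.++⁻ʳ is i<s) ∷ all-before-last is rising

  -- The last edge, read backwards, is a flip out of `I`; all earlier labels are smaller, so from
  -- its label onwards `J` still agrees with `P`.
  source-father-leaves : ∀ {P I J} (f : IsNegativeSourceFather P I J) →
    Source.Leaves I P (𝗇 (proj₁ (proj₂ f)))
  source-father-leaves (π , e@(a , r<s) , rising) =
    Source.leaves-step (adjacent-sym a) r<s (λ k s≮k → ≡.sym (source-unchanged π below s≮k))
    where
    below : All (_< 𝗇 e) (labels 𝗇 π)
    below = all-before-last (labels 𝗇 π) (≡.subst (AllPairs _<_) (labels-◅◅ 𝗇 π (e ◅ ε))
      (Linked⇒AllPairs Fin.<-trans rising))

  chain⇒sink-father : ∀ {N I i is} → Sink.Chain N I (i ∷ is) → AllPairs _<_ (i ∷ is) →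
    ∃[ J ] IsPositiveSinkFather N I J
  chain⇒sink-father (e Sink.∷ c) rising =
    _ , e , proj₁ (sink-path c) ,
    AllPairs⇒Linked (≡.subst (λ js → AllPairs _<_ (𝗉 e ∷ js)) (≡.sym (proj₂ (sink-path c))) rising)

  sink-father : ∀ {N} → IsNegativeGreedy N → ∀ {I} → IsFacet I → I ≢ N →
    ∃[ J ] IsPositiveSinkFather N I J
  sink-father (N-facet , no-successor) I-facet I≢N =
    let i , is , c , rising = Sink.chain (facet N-facet) (λ a i<j → no-successor _ (a , i<j))
                                (facet I-facet) I≢N
    in chain⇒sink-father c rising

  sink-father-unique : ∀ {N I J K} → IsPositiveSinkFather N I J → IsPositiveSinkFather N I K → J ≡ K
  sink-father-unique f@((a , _) , _) g@((b , _) , _) =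
    flip-unique a b (Sink.leaves-unique (sink-father-leaves f) (sink-father-leaves g))

  sink-father-flip : ∀ {N I J} → IsPositiveSinkFather N I J →
    ∃[ i ] (IsSmallest i (I ─ N) × FlipsTo I i J)
  sink-father-flip {N} {I} f@((a , _) , _) with sink-father-leaves f
  ... | Sink.leaving same i∈I i∉N = removed a , (∈─ I N i∈I i∉N , smallest) , a , refl
    where
    smallest : ∀ k → k ∈ I ─ N → removed a ≤ k
    smallest k k∈I─N = ℕ.≮⇒≥ (λ k<i → ∈─⇒≢ I N k∈I─N (same k k<i))

  chain⇒source-father : ∀ {P I i is} → Source.Chain P I (i ∷ is) → AllPairs (flip _<_) (i ∷ is) →
    ∃[ J ] IsNegativeSourceFather P I J
  chain⇒source-father (e Source.∷ c) falling =
    _ , proj₁ (source-path c) , reverse-edge e ,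
    AllPairs⇒Linked (≡.subst (AllPairs _<_) (≡.sym (labels-source-path e c)) (reverse-rising falling))

  source-father : ∀ {P} → IsPositiveGreedy P → ∀ {I} → IsFacet I → I ≢ P →
    ∃[ J ] IsNegativeSourceFather P I J
  source-father (P-facet , no-predecessor) I-facet I≢P =
    let i , is , c , falling = Source.chain (facet P-facet) (λ a j<i → no-predecessor _ (adjacent-sym a , j<i))
                                 (facet I-facet) I≢P
    in chain⇒source-father c falling

  source-father-unique : ∀ {P I J K} →
    IsNegativeSourceFather P I J → IsNegativeSourceFather P I K → J ≡ K
  source-father-unique f@(_ , (a , _) , _) g@(_ , (b , _) , _) =
    flip-unique (adjacent-sym a) (adjacent-sym b)
      (Source.leaves-unique (source-father-leaves f) (source-father-leaves g))

  source-father-flip : ∀ {P I J} → IsNegativeSourceFather P I J →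
    ∃[ i ] (IsLargest i (I ─ P) × FlipsTo I i J)
  source-father-flip {P} {I} f@(_ , (a , _) , _) with source-father-leaves f
  ... | Source.leaving same i∈I i∉P = inserted a , (∈─ I P i∈I i∉P , largest) , adjacent-sym a , refl
    where
    largest : ∀ k → k ∈ I ─ P → k ≤ inserted a
    largest k k∈I─P = ℕ.≮⇒≥ (λ i<k → ∈─⇒≢ I P k∈I─P (same k i<k))

proposition4p14 :
    ∀ {c ℓ} (C : CoxeterSystem c ℓ) (let open CoxeterSystem C) → IsFinite group →
    ∀ {m} (Q : Vec (Fin rank) m) (ρ : Carrier) (let open SubwordComplex C Q ρ) →
    ∀ (I : Subset m) → IsFacet I →
      (∀ N → IsNegativeGreedy N → I ≢ N →
        ∃! _≡_ (IsPositiveSinkFather N I)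
        × (∀ J → IsPositiveSinkFather N I J →
            ∃[ i ] (IsSmallest i (I ─ N) × FlipsTo I i J)))
      × (∀ P → IsPositiveGreedy P → I ≢ P →
        ∃! _≡_ (IsNegativeSourceFather P I)
        × (∀ J → IsNegativeSourceFather P I J →
            ∃[ i ] (IsLargest i (I ─ P) × FlipsTo I i J)))
proposition4p14 C finite Q ρ I I-facet =
  (λ N N-greedy I≢N →
    let J , J-father = sink-father N-greedy I-facet I≢N
    in (J , J-father , sink-father-unique J-father) , λ _ → sink-father-flip) ,
  (λ P P-greedy I≢P →
    let J , J-father = source-father P-greedy I-facet I≢P
    in (J , J-father , source-father-unique J-father) , λ _ → source-father-flip)
  where
  open Facets C (finite⇒decidable (CoxeterSystem.group C) finite) Q ρ
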